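{- For all integers $c>0$ and $1\le i\le c$, the labelled $i$-grid $T^{c,i}$ possesses vertical symmetry and slide symmetry.
   Context: **Labelled grids.** For $n\ge 1$, an $n$-grid is the triangular graph made of $n$ rows of upright triangles: row $r$ ($1\le r\le n$, counted from the top) contains the upright triangles $T_{r,d}$, $1\le d\le r$, counted from the left. The edges of the graph are exactly the left, right and base edges of the upright triangles, and each edge belongs to exactly one upright triangle. A labelled $n$-grid $T$ is an assignment of positive real labels (resistances) $T_{L,r,d},T_{R,r,d},T_{B,r,d}$ to the left, right and base edges of each $T_{r,d}$, $1\le d\le r\le n$. **Symmetries.** A labelled $n$-grid $T$ possesses *vertical symmetry* if $T_{L,r,d}=T_{R,r,r+1-d}$ and $T_{B,r,d}=T_{B,r,r+1-d}$ for all $1\le d\le r\le n$. It possesses *slide symmetry* if $T_{L,r,d}=T_{L,n+d-r,d}$ and $T_{R,r,d}=T_{B,n+d-r,d}$ for all $1\le d\le r\le n$. **Edge-ratio functions.** $$r_{R,L}(r,d)=\frac{2(r-d)+1}{2d-1},\qquad r_{B,L}(n,r,d)=\frac{2(n-r)+1}{2d-1},$$ $$x(n,r)=\frac{r-1}{2r-1}\cdot\frac{2(n-r)+3}{(n-r)+1},\qquad y(r,d)=\frac{d-1}{2d-3}\cdot\frac{2(r-d)+3}{(r-d)+1}.$$ **Initial non-one grid.** $T^{c}$ is the labelled $c$-grid determined by $T_{L,1,1}=1$ and $T_{L,r,1}=x(c,r)\,T_{L,r-1,1}$ for $2\le r\le c$; $T_{L,r,d}=y(r,d)\,T_{L,r,d-1}$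 for $2\le d\le r\le c$; $T_{R,r,d}=r_{R,L}(r,d)\,T_{L,r,d}$ and $T_{B,r,d}=r_{B,L}(c,r,d)\,T_{L,r,d}$ for $1\le d\le r\le c$. **Row reduction.** Let $\Delta(u,v,w)=\frac{uv}{u+v+w}$ and $Y(u,v,w)=\frac{uv+vw+wu}{u}$. Given a labelled $n$-grid $T$ (the parent), $n\ge2$, apply the $\Delta$–Y transformation to each upright triangle, giving legs $$Y_{12,r,d}=\Delta(T_{L,r,d},T_{R,r,d},T_{B,r,d}),\quad Y_{4,r,d}=\Delta(T_{R,r,d},T_{B,r,d},T_{L,r,d}),\quad Y_{8,r,d}=\Delta(T_{B,r,d},T_{L,r,d},T_{R,r,d})$$ (from the center of the triangle to its top, lower right, lower left vertex respectively); discard the three corner tails $Y_{12,1,1},Y_{8,n,1},Y_{4,n,n}$; combine consecutive boundary legs in series; and apply the Y–$\Delta$ transformation to the remaining stars. The result is the row-reduced (child) labelled $(n-1)$-grid $T'$ with, explicitly: - $T'_{L,r,1}=Y_{8,r,1}+Y_{12,r+1,1}$ for $1\le r\le n-1$; - $T'_{R,r,r}=Y_{4,r,r}+Y_{12,r+1,r+1}$ for $1\le r\le n-1$; - $T'_{B,n-1,d}=Y_{4,n,d}+Y_{8,n,d+1}$ for $1\le d\le n-1$; - $T'_{L,r,d}=Y(Y_{4,r,d-1},Y_{8,r,d},Y_{12,r+1,d})$ for $2\le d\le r\le n-1$; - $T'_{R,r,d}=Y(Y_{8,r,d+1},Y_{4,r,d},Y_{12,r+1,d+1})$ for $1\le d\le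 r-1$, $r\le n-1$; - $T'_{B,r,d}=Y(Y_{12,r+2,d+1},Y_{4,r+1,d},Y_{8,r+1,d+1})$ for $1\le d\le r\le n-2$. For $1\le i\le c$, $T^{c,i}$ is the labelled $i$-grid obtained from $T^c$ by $c-i$ consecutive row reductions (so $T^{c,c}=T^c$). -}

module Defs where

open import Data.Nat as ℕ
  using (ℕ; zero; suc; _∸_; _≤_; z≤n; s≤s; _≤′_; ≤′-refl; ≤′-step; >-nonZero)
import Data.Nat.Properties as ℕ
open import Data.Integer using (+_)
open import Data.Product using (_×_)
open import Data.Rational as ℚ using (ℚ; Positive)
import Data.Rational.Properties as ℚ
open import Relation.Binary.PropositionalEquality using (_≡_; sym; subst)
open import Relation.Nullary using (yes; no)

-- The labels of the grids considered are obtained from 1 by field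
-- operations on positive numbers, so positive rationals stand in for
-- positive reals.  Positivity is irrelevant, so that _≡_ on ℚ⁺ is
-- equality of the underlying rationals.

record ℚ⁺ : Set where
  constructor pos
  field
    value       : ℚ
    .isPositive : Positive value

open ℚ⁺ public using (value)

infixl 6 _+_
infixl 7 _*_ _÷_

_+_ _*_ _÷_ : ℚ⁺ → ℚ⁺ → ℚ⁺
pos p p>0 + pos q q>0 = pos (p ℚ.+ q) (ℚ.pos+pos⇒pos p {{p>0}} q {{q>0}})
pos p p>0 * pos q q>0 = pos (p ℚ.* q) (ℚ.pos*pos⇒pos p {{p>0}} q {{q>0}})
pos p p>0 ÷ pos q q>0 =
  pos ((p ℚ.÷ q) {{ℚ.pos⇒nonZero q {{q>0}}}})
      (ℚ.pos*pos⇒pos p {{p>0}} _ {{ℚ.1/pos⇒pos q {{q>0}}}})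

1⁺ : ℚ⁺
1⁺ = pos ℚ.1ℚ _

infixl 7 _/_

_/_ : (m n : ℕ) .{{_ : ℕ.NonZero m}} .{{_ : ℕ.NonZero n}} → ℚ⁺
m / n = pos (+ m ℚ./ n) (ℚ.normalize-pos m n)

-- The d-th upright triangle of row r, both counted from 1.

record Triangle (n : ℕ) : Set where
  constructor tri
  field
    r d  : ℕ
    .1≤d : 1 ≤ d
    .d≤r : d ≤ r
    .r≤n : r ≤ n

data Side : Set where
  L R B : Side

Grid : ℕ → Set
Grid n = Side → Triangle n → ℚ⁺

1≤r+1∸d : ∀ {r d} → d ≤ r → 1 ≤ r ℕ.+ 1 ∸ d
1≤r+1∸d {r} {d} d≤r =
  subst (λ k → 1 ≤ k ∸ d) (ℕ.+-comm 1 r) (ℕ.m<n⇒0<n∸m (s≤s d≤r))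

r+1∸d≤r : ∀ {r d} → 1 ≤ d → r ℕ.+ 1 ∸ d ≤ r
r+1∸d≤r {r} {d} 1≤d =
  subst (λ k → k ∸ d ≤ r) (ℕ.+-comm 1 r) (ℕ.∸-monoʳ-≤ (suc r) 1≤d)

d≤n+d∸r : ∀ {n r d} → r ≤ n → d ≤ n ℕ.+ d ∸ r
d≤n+d∸r {n} {r} {d} r≤n =
  ℕ.≤-trans (ℕ.≤-reflexive (sym (ℕ.m+n∸m≡n r d)))
            (ℕ.∸-monoˡ-≤ r (ℕ.+-monoˡ-≤ d r≤n))

n+d∸r≤n : ∀ {n r d} → d ≤ r → n ℕ.+ d ∸ r ≤ n
n+d∸r≤n {n} {r} {d} d≤r =
  ℕ.≤-trans (ℕ.∸-monoʳ-≤ (n ℕ.+ d) d≤r)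
            (ℕ.≤-reflexive (ℕ.m+n∸n≡m n d))

mirror : ∀ {n} → Triangle n → Triangle n
mirror (tri r d 1≤d d≤r r≤n) =
  tri r (r ℕ.+ 1 ∸ d) (1≤r+1∸d d≤r) (r+1∸d≤r 1≤d) r≤n

slide : ∀ {n} → Triangle n → Triangle n
slide {n} (tri r d 1≤d d≤r r≤n) =
  tri (n ℕ.+ d ∸ r) d 1≤d (d≤n+d∸r r≤n) (n+d∸r≤n d≤r)

VerticalSymmetry : ∀ {n} → Grid n → Set
VerticalSymmetry T =
  ∀ t → T L t ≡ T R (mirror t) × T B t ≡ T B (mirror t)

SlideSymmetry : ∀ {n} → Grid n → Set
SlideSymmetry T =
  ∀ t → T L t ≡ T L (slide t) × T R t ≡ T B (slide t)

-- Subtraction of naturals is truncated, so 2d - 1 and 2d - 3 are written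
-- as 1 + 2 (d ∸ 1) and 1 + 2 (d ∸ 2); these agree in the ranges 1 ≤ d and
-- 2 ≤ d where the ratios are used.

rRL : (r d : ℕ) → ℚ⁺
rRL r d = (1 ℕ.+ 2 ℕ.* (r ∸ d)) / (1 ℕ.+ 2 ℕ.* (d ∸ 1))

rBL : (n r d : ℕ) → ℚ⁺
rBL n r d = (1 ℕ.+ 2 ℕ.* (n ∸ r)) / (1 ℕ.+ 2 ℕ.* (d ∸ 1))

x : (n r : ℕ) → .(2 ≤ r) → ℚ⁺
x n r 2≤r =
  ((r ∸ 1) / (1 ℕ.+ 2 ℕ.* (r ∸ 1))) {{>-nonZero (ℕ.m<n⇒0<n∸m 2≤r)}}
    * ((3 ℕ.+ 2 ℕ.* (n ∸ r)) / (1 ℕ.+ (n ∸ r)))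

y : (r d : ℕ) → .(2 ≤ d) → ℚ⁺
y r d 2≤d =
  ((d ∸ 1) / (1 ℕ.+ 2 ℕ.* (d ∸ 2))) {{>-nonZero (ℕ.m<n⇒0<n∸m 2≤d)}}
    * ((3 ℕ.+ 2 ℕ.* (r ∸ d)) / (1 ℕ.+ (r ∸ d)))

initialL : (c r d : ℕ) → .(1 ≤ d) → .(d ≤ r) → ℚ⁺
initialL c r             (suc (suc d)) _ d≤r =
  y r (suc (suc d)) (s≤s (s≤s z≤n))
    * initialL c r (suc d) (s≤s z≤n) (ℕ.<⇒≤ d≤r)
initialL c 1             1             _ _   = 1⁺
initialL c (suc (suc r)) 1             _ _   =
  x c (suc (suc r)) (s≤s (s≤s z≤n))
    * initialL c (suc r) 1 (s≤s z≤n) (s≤s z≤n)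

initial : (c : ℕ) → Grid c
initial c L (tri r d 1≤d d≤r r≤c) = initialL c r d 1≤d d≤r
initial c R (tri r d 1≤d d≤r r≤c) = rRL r d * initialL c r d 1≤d d≤r
initial c B (tri r d 1≤d d≤r r≤c) = rBL c r d * initialL c r d 1≤d d≤r

Δ : ℚ⁺ → ℚ⁺ → ℚ⁺ → ℚ⁺
Δ u v w = u * v ÷ (u + v + w)

Y : ℚ⁺ → ℚ⁺ → ℚ⁺ → ℚ⁺
Y u v w = (u * v + v * w + w * u) ÷ u

-- Legs from the centre to the top, lower right and lower left vertex.

Y₁₂ Y₄ Y₈ : ∀ {n} → Grid n → Triangle n → ℚ⁺
Y₁₂ T t = Δ (T L t) (T R t) (T B t)
Y₄  T t = Δ (T R t) (T B t) (T L t)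
Y₈  T t = Δ (T B t) (T L t) (T R t)

-- The parent has n = suc m rows, the child m = n - 1.

rowReduce : ∀ {m} → Grid (suc m) → Grid m
rowReduce T L (tri r 1 1≤d d≤r r≤m) =
    Y₈  T (tri r 1 1≤d d≤r (ℕ.m≤n⇒m≤1+n r≤m))
  + Y₁₂ T (tri (suc r) 1 1≤d (s≤s z≤n) (s≤s r≤m))
rowReduce T L (tri r (suc (suc d)) 1≤d d≤r r≤m) =
  Y (Y₄  T (tri r (suc d) (s≤s z≤n) (ℕ.<⇒≤ d≤r) (ℕ.m≤n⇒m≤1+n r≤m)))
    (Y₈  T (tri r (suc (suc d)) 1≤d d≤r (ℕ.m≤n⇒m≤1+n r≤m)))
    (Y₁₂ T (tri (suc r) (suc (suc d)) 1≤d (ℕ.m≤n⇒m≤1+n d≤r) (s≤s r≤m)))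
rowReduce T R (tri r d 1≤d d≤r r≤m) with d ℕ.≟ r
... | yes _ =
    Y₄  T (tri r d 1≤d d≤r (ℕ.m≤n⇒m≤1+n r≤m))
  + Y₁₂ T (tri (suc r) (suc d) (s≤s z≤n) (s≤s d≤r) (s≤s r≤m))
... | no d≢r =
  Y (Y₈  T (tri r (suc d) (s≤s z≤n) (ℕ.≤∧≢⇒< d≤r d≢r) (ℕ.m≤n⇒m≤1+n r≤m)))
    (Y₄  T (tri r d 1≤d d≤r (ℕ.m≤n⇒m≤1+n r≤m)))
    (Y₁₂ T (tri (suc r) (suc d) (s≤s z≤n) (s≤s d≤r) (s≤s r≤m)))
rowReduce {m} T B (tri r d 1≤d d≤r r≤m) with r ℕ.≟ m
... | yes _ =
    Y₄ T (tri (suc r) d 1≤d (ℕ.m≤n⇒m≤1+n d≤r) (s≤s r≤m))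
  + Y₈ T (tri (suc r) (suc d) (s≤s z≤n) (s≤s d≤r) (s≤s r≤m))
... | no r≢m =
  Y (Y₁₂ T (tri (suc (suc r)) (suc d) (s≤s z≤n)
                (ℕ.m≤n⇒m≤1+n (s≤s d≤r)) (s≤s (ℕ.≤∧≢⇒< r≤m r≢m))))
    (Y₄  T (tri (suc r) d 1≤d (ℕ.m≤n⇒m≤1+n d≤r) (s≤s r≤m)))
    (Y₈  T (tri (suc r) (suc d) (s≤s z≤n) (s≤s d≤r) (s≤s r≤m)))

-- i ≤′ c is built by counting up from i, so this performs exactly c - i
-- row reductions.

reduceTo : ∀ {i c} → i ≤′ c → Grid c → Grid i
reduceTo ≤′-refl       T = T
reduceTo (≤′-step i≤c) T = reduceTo i≤c (rowReduce T)

reduced : (c i : ℕ) → i ≤ c → Grid i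
reduced c i i≤c = reduceTo (ℕ.≤⇒≤′ i≤c) (initial c)

{-# OPTIONS --safe #-}

-- Let a = d − 1, b = r − d and c = n − r be the distances of T_{r,d} from the
-- left, right and base side of the grid.  Then vertical symmetry exchanges a
-- with b and L with R, and slide symmetry exchanges b with c and R with B.  So
-- a grid has both symmetries as soon as there is a g, symmetric in its last
-- two arguments, with T_L = g a b c, T_R = g b a c and T_B = g c a b.  Solving
-- the recurrences gives T^c this form with
--   g a b c = (2a + 1) f(a) f(b) f(c) / f(n − 1),   f(k) = ∏_{1 ≤ j ≤ k} j / (2j + 1),
-- and row reduction preserves it, because the Δ–Y formulas are equivariant
-- under permutations of the three sides.

module Submission where

open import Defs
open import Algebra.Bundles using (CommutativeMonoid)
import Algebra.Solver.CommutativeMonoid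
open import Data.Empty using (⊥-elim)
import Data.Integer as ℤ
import Data.Integer.Properties as ℤ
open import Data.Nat as ℕ using (ℕ; zero; suc; _∸_; _≤_; _>_; z≤n; s≤s; _≤′_; ≤′-refl; ≤′-step)
import Data.Nat.Properties as ℕ
open import Data.Product using (_×_; _,_; ∃-syntax)
import Data.Rational as ℚ
import Data.Rational.Properties as ℚ
open import Data.Rational.Unnormalised as ℚᵘ using (mkℚᵘ; *≡*)
import Data.Rational.Unnormalised.Properties as ℚᵘ
open import Level using (0ℓ)
open import Relation.Binary.PropositionalEquality
  using (_≡_; refl; sym; trans; cong; cong₂; isEquivalence; module ≡-Reasoning)
open import Relation.Nullary using (yes; no; recompute)

open ≡-Reasoning

-- Arithmetic of positive rationals.

value-injective : ∀ {p q} → value p ≡ value q → p ≡ q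
value-injective refl = refl

+-assoc : ∀ p q r → (p + q) + r ≡ p + (q + r)
+-assoc p q r = value-injective (ℚ.+-assoc (value p) (value q) (value r))

+-comm : ∀ p q → p + q ≡ q + p
+-comm p q = value-injective (ℚ.+-comm (value p) (value q))

*-assoc : ∀ p q r → (p * q) * r ≡ p * (q * r)
*-assoc p q r = value-injective (ℚ.*-assoc (value p) (value q) (value r))

*-comm : ∀ p q → p * q ≡ q * p
*-comm p q = value-injective (ℚ.*-comm (value p) (value q))

*-identityˡ : ∀ p → 1⁺ * p ≡ p
*-identityˡ p = value-injective (ℚ.*-identityˡ (value p))

*-identityʳ : ∀ p → p * 1⁺ ≡ p
*-identityʳ p = value-injective (ℚ.*-identityʳ (value p))

*-1-commutativeMonoid : CommutativeMonoid 0ℓ 0ℓ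
*-1-commutativeMonoid = record
  { isCommutativeMonoid = record
    { isMonoid = record
      { isSemigroup = record
        { isMagma = record { isEquivalence = isEquivalence ; ∙-cong = cong₂ _*_ }
        ; assoc   = *-assoc
        }
      ; identity = *-identityˡ , *-identityʳ
      }
    ; comm = *-comm
    }
  }

module *-Solver = Algebra.Solver.CommutativeMonoid *-1-commutativeMonoid

p*[1÷p]≡1 : ∀ p → p * (1⁺ ÷ p) ≡ 1⁺
p*[1÷p]≡1 (pos p p>0) = value-injective
  (trans (cong (p ℚ.*_) (ℚ.*-identityˡ _)) (ℚ.*-inverseʳ p {{ℚ.pos⇒nonZero p {{p>0}}}}))

n/n≡1 : ∀ n → suc n / suc n ≡ 1⁺
n/n≡1 n = value-injective (ℚ.fromℚᵘ-cong {mkℚᵘ (ℤ.+ suc n) n} {ℚᵘ.1ℚᵘ}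
  (*≡* (ℤ.*-comm (ℤ.+ suc n) (ℤ.+ 1))))

toℚᵘ-/ : ∀ m n → ℚ.toℚᵘ (ℤ.+ suc m ℚ./ suc n) ℚᵘ.≃ mkℚᵘ (ℤ.+ suc m) n
toℚᵘ-/ m n = ℚ.toℚᵘ-fromℚᵘ (mkℚᵘ (ℤ.+ suc m) n)

-- On unnormalised fractions, cross-multiplication reduces the cancellation of `suc n` to
-- associativity in ℕ.
/-*-/ : ∀ m n k → (suc m / suc n) * (suc n / suc k) ≡ suc m / suc k
/-*-/ m n k = value-injective (ℚ.toℚᵘ-injective
  (ℚᵘ.≃-trans (ℚ.toℚᵘ-homo-* (ℤ.+ suc m ℚ./ suc n) (ℤ.+ suc n ℚ./ suc k))
  (ℚᵘ.≃-trans (ℚᵘ.*-cong (toℚᵘ-/ m n) (toℚᵘ-/ n k))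
  (ℚᵘ.≃-trans (*≡* (cong ℤ.+_ (ℕ.*-assoc (suc m) (suc n) (suc k))))
              (ℚᵘ.≃-sym (toℚᵘ-/ m k))))))

cong₃ : (φ : ℚ⁺ → ℚ⁺ → ℚ⁺ → ℚ⁺) → ∀ {u u′ v v′ w w′} →
  u ≡ u′ → v ≡ v′ → w ≡ w′ → φ u v w ≡ φ u′ v′ w′
cong₃ φ refl refl refl = refl

Δ-swap : ∀ u v w → Δ u v w ≡ Δ v u w
Δ-swap u v w = cong₂ _÷_ (*-comm u v) (cong (_+ w) (+-comm u v))

Y-swap : ∀ u v w → Y u v w ≡ Y u w v
Y-swap u v w = cong (_÷ u) (begin
  u * v + v * w + w * u    ≡⟨ +-comm (u * v + v * w) (w * u) ⟩
  w * u + (u * v + v * w)  ≡⟨ cong (w * u +_) (+-comm (u * v) (v * w)) ⟩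
  w * u + (v * w + u * v)  ≡⟨ sym (+-assoc (w * u) (v * w) (u * v)) ⟩
  w * u + v * w + u * v    ≡⟨ cong₂ _+_ (cong₂ _+_ (*-comm w u) (*-comm v w)) (*-comm u v) ⟩
  u * w + w * v + v * u    ∎)

-- Distances of a triangle from the three sides.

recompute-≤ : ∀ {m n} → .(m ≤ n) → m ≤ n
recompute-≤ {m} {n} = recompute (m ℕ.≤? n)

-- Equations rather than truncated differences: matching them with `refl` turns `d`, `r` and `n`
-- into sums.
record Coordinates {n} (t : Triangle n) (a b c : ℕ) : Set where
  constructor coordinates
  field
    d≡ : Triangle.d t ≡ suc a
    r≡ : Triangle.r t ≡ Triangle.d t ℕ.+ b
    n≡ : n ≡ Triangle.r t ℕ.+ c

findCoordinates : ∀ {n} (t : Triangle n) → ∃[ a ] ∃[ b ] ∃[ c ] Coordinates t a b c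
findCoordinates {n} (tri r d 1≤d d≤r r≤n) = d ∸ 1 , r ∸ d , n ∸ r , coordinates
  (sym (ℕ.m+[n∸m]≡n (recompute-≤ 1≤d)))
  (sym (ℕ.m+[n∸m]≡n (recompute-≤ d≤r)))
  (sym (ℕ.m+[n∸m]≡n (recompute-≤ r≤n)))

mirror-coordinates : ∀ {n} (t : Triangle n) {a b c} →
  Coordinates t a b c → Coordinates (mirror t) b a c
mirror-coordinates (tri r d 1≤d d≤r r≤n) {a} {b} (coordinates refl refl refl) =
  coordinates d′≡ r≡ refl
  where
  d′≡ : suc (a ℕ.+ b) ℕ.+ 1 ∸ suc a ≡ suc b
  d′≡ = begin
    a ℕ.+ b ℕ.+ 1 ∸ a    ≡⟨ cong (_∸ a) (ℕ.+-assoc a b 1) ⟩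
    a ℕ.+ (b ℕ.+ 1) ∸ a  ≡⟨ ℕ.m+n∸m≡n a (b ℕ.+ 1) ⟩
    b ℕ.+ 1              ≡⟨ ℕ.+-comm b 1 ⟩
    suc b                ∎
  r≡ : suc (a ℕ.+ b) ≡ (suc (a ℕ.+ b) ℕ.+ 1 ∸ suc a) ℕ.+ a
  r≡ = trans (cong suc (ℕ.+-comm a b)) (cong (ℕ._+ a) (sym d′≡))

slide-coordinates : ∀ {n} (t : Triangle n) {a b c} →
  Coordinates t a b c → Coordinates (slide t) a c b
slide-coordinates (tri r d 1≤d d≤r r≤n) {a} {b} {c} (coordinates refl refl refl) =
  coordinates refl r′≡ n≡
  where
  r′≡ : suc a ℕ.+ b ℕ.+ c ℕ.+ suc a ∸ (suc a ℕ.+ b) ≡ suc a ℕ.+ c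
  r′≡ = begin
    suc a ℕ.+ b ℕ.+ c ℕ.+ suc a ∸ (suc a ℕ.+ b)
      ≡⟨ cong (_∸ (suc a ℕ.+ b)) (ℕ.+-assoc (suc a ℕ.+ b) c (suc a)) ⟩
    suc a ℕ.+ b ℕ.+ (c ℕ.+ suc a) ∸ (suc a ℕ.+ b)
      ≡⟨ ℕ.m+n∸m≡n (suc a ℕ.+ b) (c ℕ.+ suc a) ⟩
    c ℕ.+ suc a
      ≡⟨ ℕ.+-comm c (suc a) ⟩
    suc a ℕ.+ c
      ∎
  n≡ : suc a ℕ.+ b ℕ.+ c ≡ suc a ℕ.+ b ℕ.+ c ℕ.+ suc a ∸ (suc a ℕ.+ b) ℕ.+ b
  n≡ = begin
    suc a ℕ.+ b ℕ.+ c    ≡⟨ ℕ.+-assoc (suc a) b c ⟩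
    suc a ℕ.+ (b ℕ.+ c)  ≡⟨ cong (suc a ℕ.+_) (ℕ.+-comm b c) ⟩
    suc a ℕ.+ (c ℕ.+ b)  ≡⟨ sym (ℕ.+-assoc (suc a) c b) ⟩
    suc a ℕ.+ c ℕ.+ b    ≡⟨ cong (ℕ._+ b) (sym r′≡) ⟩
    suc a ℕ.+ b ℕ.+ c ℕ.+ suc a ∸ (suc a ℕ.+ b) ℕ.+ b  ∎

-- Grids generated by one function, and their symmetries.

Symmetric : (ℕ → ℕ → ℕ → ℚ⁺) → Set
Symmetric g = ∀ a b c → g a b c ≡ g a c b

label : (ℕ → ℕ → ℕ → ℚ⁺) → Side → ℕ → ℕ → ℕ → ℚ⁺
label g L a b c = g a b c
label g R a b c = g b a c
label g B a b c = g c a b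

_GeneratedBy_ : ∀ {n} → Grid n → (ℕ → ℕ → ℕ → ℚ⁺) → Set
T GeneratedBy g = ∀ s t {a b c} → Coordinates t a b c → T s t ≡ label g s a b c

-- Since `mirror` exchanges a and b, the L- and R-labels agree definitionally, while the base labels
-- differ by an exchange of the last two arguments of `g`.
generated⇒verticalSymmetry : ∀ {n} {T : Grid n} {g} →
  Symmetric g → T GeneratedBy g → VerticalSymmetry T
generated⇒verticalSymmetry g-sym gen t with findCoordinates t
... | a , b , c , co =
    trans (gen L t co) (sym (gen R (mirror t) (mirror-coordinates t co)))
  , trans (gen B t co) (trans (g-sym c a b) (sym (gen B (mirror t) (mirror-coordinates t co))))

generated⇒slideSymmetry : ∀ {n} {T : Grid n} {g} →
  Symmetric g → T GeneratedBy g → SlideSymmetry T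
generated⇒slideSymmetry g-sym gen t with findCoordinates t
... | a , b , c , co =
    trans (gen L t co) (trans (g-sym a b c) (sym (gen L (slide t) (slide-coordinates t co))))
  , trans (gen R t co) (sym (gen B (slide t) (slide-coordinates t co)))

-- Row reduction of generated grids.

-- The leg opposite to the side at distance a.
leg : (ℕ → ℕ → ℕ → ℚ⁺) → ℕ → ℕ → ℕ → ℚ⁺
leg g a b c = Δ (g b a c) (g c a b) (g a b c)

abstract

  -- At a = 0 the child's L-edge lies on the boundary and its star has only two
  -- legs.  Abstract because `with` normalises the goal, and the normal forms of
  -- these sums and quotients of rationals are huge.
  reduce : (ℕ → ℕ → ℕ → ℚ⁺) → (ℕ → ℕ → ℕ → ℚ⁺)
  reduce g zero    b c = leg g b 0 (suc c) + leg g c 0 (suc b)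
  reduce g (suc a) b c =
    Y (leg g a (suc b) (suc c)) (leg g b (suc a) (suc c)) (leg g c (suc a) (suc b))

  -- Outside this block `reduce` does not unfold; this equation and the next stand for its clauses.
  reduce-zero : ∀ g b c → leg g b 0 (suc c) + leg g c 0 (suc b) ≡ reduce g 0 b c
  reduce-zero g b c = refl

  reduce-suc : ∀ g a b c →
    Y (leg g a (suc b) (suc c)) (leg g b (suc a) (suc c)) (leg g c (suc a) (suc b))
      ≡ reduce g (suc a) b c
  reduce-suc g a b c = refl

module _ {g : ℕ → ℕ → ℕ → ℚ⁺} (g-sym : Symmetric g) where

  -- Exchanging b and c swaps the first two arguments of `Δ`, in which it is symmetric; the third is
  -- unchanged by `g-sym`.
  leg-symmetric : Symmetric (leg g)
  leg-symmetric a b c =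
    trans (Δ-swap (g b a c) (g c a b) (g a b c)) (cong (Δ (g c a b) (g b a c)) (g-sym a b c))

  reduce-symmetric : Symmetric (reduce g)
  reduce-symmetric zero    b c = begin
    reduce g 0 b c                             ≡⟨ sym (reduce-zero g b c) ⟩
    leg g b 0 (suc c) + leg g c 0 (suc b)      ≡⟨ +-comm (leg g b 0 (suc c)) (leg g c 0 (suc b)) ⟩
    leg g c 0 (suc b) + leg g b 0 (suc c)      ≡⟨ reduce-zero g c b ⟩
    reduce g 0 c b                             ∎
  reduce-symmetric (suc a) b c = begin
    reduce g (suc a) b c  ≡⟨ sym (reduce-suc g a b c) ⟩
    Y (leg g a (suc b) (suc c)) l₂ l₃
      ≡⟨ Y-swap (leg g a (suc b) (suc c)) l₂ l₃ ⟩
    Y (leg g a (suc b) (suc c)) l₃ l₂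
      ≡⟨ cong (λ l₁ → Y l₁ l₃ l₂) (leg-symmetric a (suc b) (suc c)) ⟩
    Y (leg g a (suc c) (suc b)) l₃ l₂
      ≡⟨ reduce-suc g a c b ⟩
    reduce g (suc a) c b  ∎
    where
    l₂ = leg g b (suc a) (suc c)
    l₃ = leg g c (suc a) (suc b)

  module _ {n : ℕ} {T : Grid n} (gen : T GeneratedBy g) (t : Triangle n) {a b c : ℕ} where

    -- The top, lower right and lower left vertices lie opposite the base, left and right sides, so
    -- here and in the next two lemmas the leading argument is c, a and b respectively.
    Y₁₂-leg : Coordinates t a b c → Y₁₂ T t ≡ leg g c a b
    Y₁₂-leg co = cong₃ Δ (trans (gen L t co) (g-sym a b c))
                         (trans (gen R t co) (g-sym b a c))
                         (gen B t co)

    Y₄-leg : Coordinates t a b c → Y₄ T t ≡ leg g a b c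
    Y₄-leg co = cong₃ Δ (gen R t co) (gen B t co) (gen L t co)

    Y₈-leg : Coordinates t a b c → Y₈ T t ≡ leg g b a c
    Y₈-leg co = trans (Δ-swap (T B t) (T L t) (T R t))
      (cong₃ Δ (gen L t co) (trans (gen B t co) (g-sym c a b)) (gen R t co))

  -- A child L-edge at distances (a, b, c) collects legs from the parent triangles at (a, b, c + 1),
  -- (a, b + 1, c) and, if a > 0, (a - 1, b + 1, c + 1), as in `reduce`. R and B follow the same
  -- pattern with the distances permuted, up to `leg-symmetric`.
  rowReduce-generated : ∀ {m} {T : Grid (suc m)} →
    T GeneratedBy g → rowReduce T GeneratedBy reduce g
  rowReduce-generated gen L (tri r 1 _ _ _) {b = b} {c} (coordinates refl refl refl) = trans
    (cong₂ _+_
      (Y₈-leg gen (tri r 1 _ _ _) (coordinates refl refl (sym (ℕ.+-suc r c))))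
      (Y₁₂-leg gen (tri (suc r) 1 _ _ _) (coordinates refl refl refl)))
    (reduce-zero g b c)
  rowReduce-generated gen L (tri r d@(suc (suc a)) _ _ _) {b = b} {c} (coordinates refl refl refl) =
   trans
    (cong₃ Y
      (Y₄-leg gen (tri r (suc a) _ _ _)
        (coordinates refl (sym (ℕ.+-suc (suc a) b)) (sym (ℕ.+-suc r c))))
      (Y₈-leg gen (tri r d _ _ _) (coordinates refl refl (sym (ℕ.+-suc r c))))
      (Y₁₂-leg gen (tri (suc r) d _ _ _) (coordinates refl (sym (ℕ.+-suc d b)) refl)))
    (reduce-suc g a b c)
  -- The test `d ≟ r` in `rowReduce` succeeds exactly when b = 0; for B, the test `r ≟ m` succeeds
  -- exactly when c = 0.
  rowReduce-generated gen R (tri r d _ _ _) {a} {zero} {c} (coordinates refl refl refl)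
    with d ℕ.≟ r
  ... | no d≢r = ⊥-elim (d≢r (sym (ℕ.+-identityʳ d)))
  ... | yes _  = trans
    (cong₂ _+_
      (Y₄-leg gen (tri r d _ _ _) (coordinates refl refl (sym (ℕ.+-suc r c))))
      (trans (Y₁₂-leg gen (tri (suc r) (suc d) _ _ _) (coordinates refl refl refl))
             (leg-symmetric c (suc a) 0)))
    (reduce-zero g a c)
  rowReduce-generated gen R (tri r d _ _ _) {a} {suc b} {c} (coordinates refl refl refl)
    with d ℕ.≟ r
  ... | yes d≡r = ⊥-elim (ℕ.m+1+n≢m d (sym d≡r))
  ... | no _    = trans
    (cong₃ Y
      (Y₈-leg gen (tri r (suc d) _ _ _) (coordinates refl (ℕ.+-suc d b) (sym (ℕ.+-suc r c))))
      (Y₄-leg gen (tri r d _ _ _) (coordinates refl refl (sym (ℕ.+-suc r c))))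
      (trans (Y₁₂-leg gen (tri (suc r) (suc d) _ _ _) (coordinates refl refl refl))
             (leg-symmetric c (suc a) (suc b))))
    (reduce-suc g b a c)
  rowReduce-generated {m} gen B (tri r d _ _ _) {a} {b} {zero} (coordinates refl refl refl)
    with r ℕ.≟ m
  ... | no r≢m = ⊥-elim (r≢m (sym (ℕ.+-identityʳ r)))
  ... | yes _  = trans
    (cong₂ _+_
      (trans (Y₄-leg gen (tri (suc r) d _ _ _) (coordinates refl (sym (ℕ.+-suc d b)) refl))
             (leg-symmetric a (suc b) 0))
      (trans (Y₈-leg gen (tri (suc r) (suc d) _ _ _) (coordinates refl refl refl))
             (leg-symmetric b (suc a) 0)))
    (reduce-zero g a b)
  rowReduce-generated {m} gen B (tri r d _ _ _) {a} {b} {suc c} (coordinates refl refl refl)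
    with r ℕ.≟ m
  ... | yes r≡m = ⊥-elim (ℕ.m+1+n≢m r (sym r≡m))
  ... | no _    = trans
    (cong₃ Y
      (Y₁₂-leg gen (tri (suc (suc r)) (suc d) _ _ _)
        (coordinates refl (cong suc (sym (ℕ.+-suc d b))) (cong suc (ℕ.+-suc r c))))
      (trans (Y₄-leg gen (tri (suc r) d _ _ _) (coordinates refl (sym (ℕ.+-suc d b)) refl))
             (leg-symmetric a (suc b) (suc c)))
      (trans (Y₈-leg gen (tri (suc r) (suc d) _ _ _) (coordinates refl refl refl))
             (leg-symmetric b (suc a) (suc c))))
    (reduce-suc g c a b)

-- The witness `h` is `reduce` applied to `g` once per row reduction; no closed form of it enters.
reduceTo-generated : ∀ {i c} (i≤c : i ≤′ c) {T : Grid c} {g} → Symmetric g → T GeneratedBy g →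
  ∃[ h ] Symmetric h × reduceTo i≤c T GeneratedBy h
reduceTo-generated ≤′-refl       g-sym gen = _ , g-sym , gen
reduceTo-generated (≤′-step i≤c) g-sym gen =
  reduceTo-generated i≤c (reduce-symmetric g-sym) (rowReduce-generated g-sym gen)

-- Closed form of the initial grid.

odd : ℕ → ℚ⁺
odd k = (1 ℕ.+ 2 ℕ.* k) / 1

-- Equivalently k! / (2k + 1)!!.
f : ℕ → ℚ⁺
f zero    = 1⁺
f (suc k) = (suc k / (1 ℕ.+ 2 ℕ.* suc k)) * f k

-- The ratio on the left, the second factor of both `x` and `y`, is the inverse of the last factor
-- of `f (suc k)`.
f-step : ∀ k → ((3 ℕ.+ 2 ℕ.* k) / (1 ℕ.+ k)) * f (suc k) ≡ f k
f-step k = begin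
  ((3 ℕ.+ 2 ℕ.* k) / suc k) * ((suc k / (1 ℕ.+ 2 ℕ.* suc k)) * f k)
    ≡⟨ cong (λ j → ((3 ℕ.+ 2 ℕ.* k) / suc k) * ((suc k / (1 ℕ.+ j)) * f k)) (ℕ.*-suc 2 k) ⟩
  ((3 ℕ.+ 2 ℕ.* k) / suc k) * ((suc k / (3 ℕ.+ 2 ℕ.* k)) * f k)
    ≡⟨ sym (*-assoc ((3 ℕ.+ 2 ℕ.* k) / suc k) (suc k / (3 ℕ.+ 2 ℕ.* k)) (f k)) ⟩
  ((3 ℕ.+ 2 ℕ.* k) / suc k) * (suc k / (3 ℕ.+ 2 ℕ.* k)) * f k
    ≡⟨ cong (_* f k) (/-*-/ (2 ℕ.+ 2 ℕ.* k) k (2 ℕ.+ 2 ℕ.* k)) ⟩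
  ((3 ℕ.+ 2 ℕ.* k) / (3 ℕ.+ 2 ℕ.* k)) * f k
    ≡⟨ cong (_* f k) (n/n≡1 (2 ℕ.+ 2 ℕ.* k)) ⟩
  1⁺ * f k
    ≡⟨ *-identityˡ (f k) ⟩
  f k
    ∎

-- Both sides equal k + 1. The ratio on the left is the first factor of `y`; the one on the right is
-- the last factor of `f (suc k)`.
odd-step : ∀ k → (suc k / (1 ℕ.+ 2 ℕ.* k)) * odd k
                 ≡ odd (suc k) * (suc k / (1 ℕ.+ 2 ℕ.* suc k))
odd-step k = begin
  (suc k / (1 ℕ.+ 2 ℕ.* k)) * odd k
    ≡⟨ /-*-/ k (2 ℕ.* k) 0 ⟩
  suc k / 1
    ≡⟨ sym (/-*-/ k (2 ℕ.* suc k) 0) ⟩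
  (suc k / (1 ℕ.+ 2 ℕ.* suc k)) * odd (suc k)
    ≡⟨ *-comm (suc k / (1 ℕ.+ 2 ℕ.* suc k)) (odd (suc k)) ⟩
  odd (suc k) * (suc k / (1 ℕ.+ 2 ℕ.* suc k))
    ∎

module _ (κ : ℚ⁺) where

  -- The recurrences are homogeneous, so the scale `κ` stays free until `initialWeight` fixes it.
  -- `common` is the part symmetric in all three distances.
  common weight : ℕ → ℕ → ℕ → ℚ⁺
  common a b c = f a * f b * f c * κ
  weight a b c = odd a * common a b c

  common-swap₁₂ : ∀ a b c → common a b c ≡ common b a c
  common-swap₁₂ a b c = cong (λ p → p * f c * κ) (*-comm (f a) (f b))

  common-swap₂₃ : ∀ a b c → common a b c ≡ common a c b
  common-swap₂₃ a b c = solve 4 (λ p q r s → ((p ⊕ q) ⊕ r) ⊕ s ⊜ ((p ⊕ r) ⊕ q) ⊕ s) refl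
    (f a) (f b) (f c) κ
    where open *-Solver

  weight-symmetric : Symmetric weight
  weight-symmetric a b c = cong (odd a *_) (common-swap₂₃ a b c)

  -- A step to the right raises a, lowers b and keeps c. The first factor of `y` acts on a through
  -- `odd-step`, the second on b through `f-step`.
  y-weight : ∀ a b c .(2≤d : 2 ≤ suc (suc a)) →
    y (suc (suc a) ℕ.+ b) (suc (suc a)) 2≤d * weight a (suc b) c ≡ weight (suc a) b c
  y-weight a b c 2≤d = begin
    y (suc (suc a) ℕ.+ b) (suc (suc a)) 2≤d * weight a (suc b) c
      ≡⟨ cong (λ k → p * ((3 ℕ.+ 2 ℕ.* k) / (1 ℕ.+ k)) * weight a (suc b) c)
              (ℕ.m+n∸m≡n a b) ⟩
    p * q * (odd a * (f a * f (suc b) * f c * κ))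
      ≡⟨ solve 7 (λ p q o u v w k → (p ⊕ q) ⊕ (o ⊕ (((u ⊕ v) ⊕ w) ⊕ k))
                                  ⊜ (p ⊕ o) ⊕ (((u ⊕ (q ⊕ v)) ⊕ w) ⊕ k))
           refl p q (odd a) (f a) (f (suc b)) (f c) κ ⟩
    p * odd a * (f a * (q * f (suc b)) * f c * κ)
      ≡⟨ cong₂ (λ s t → s * (f a * t * f c * κ)) (odd-step a) (f-step b) ⟩
    odd (suc a) * e * (f a * f b * f c * κ)
      ≡⟨ solve 6 (λ o e u v w k → (o ⊕ e) ⊕ (((u ⊕ v) ⊕ w) ⊕ k)
                                ⊜ o ⊕ ((((e ⊕ u) ⊕ v) ⊕ w) ⊕ k))
           refl (odd (suc a)) e (f a) (f b) (f c) κ ⟩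
    odd (suc a) * (e * f a * f b * f c * κ)
      ∎
    where
    open *-Solver
    p = suc a / (1 ℕ.+ 2 ℕ.* a)
    q = (3 ℕ.+ 2 ℕ.* b) / (1 ℕ.+ b)
    e = suc a / (1 ℕ.+ 2 ℕ.* suc a)

  -- A step down the left side keeps a = 0, raises b and lowers c. The first factor of `x` is the
  -- new factor of `f (suc b)`; the second cancels the last factor of `f (suc c)`.
  x-weight : ∀ b c .(2≤r : 2 ≤ suc (suc b)) →
    x (suc (suc b) ℕ.+ c) (suc (suc b)) 2≤r * weight 0 b (suc c) ≡ weight 0 (suc b) c
  x-weight b c 2≤r = begin
    x (suc (suc b) ℕ.+ c) (suc (suc b)) 2≤r * weight 0 b (suc c)
      ≡⟨ cong (λ k → e * ((3 ℕ.+ 2 ℕ.* k) / (1 ℕ.+ k)) * weight 0 b (suc c))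
              (ℕ.m+n∸m≡n b c) ⟩
    e * q * (odd 0 * (f 0 * f b * f (suc c) * κ))
      ≡⟨ solve 7 (λ e q o u v w k → (e ⊕ q) ⊕ (o ⊕ (((u ⊕ v) ⊕ w) ⊕ k))
                                  ⊜ o ⊕ (((u ⊕ (e ⊕ v)) ⊕ (q ⊕ w)) ⊕ k))
           refl e q (odd 0) (f 0) (f b) (f (suc c)) κ ⟩
    odd 0 * (f 0 * (e * f b) * (q * f (suc c)) * κ)
      ≡⟨ cong (λ t → odd 0 * (f 0 * (e * f b) * t * κ)) (f-step c) ⟩
    weight 0 (suc b) c
      ∎
    where
    open *-Solver
    q = (3 ℕ.+ 2 ℕ.* c) / (1 ℕ.+ c)
    e = suc b / (1 ℕ.+ 2 ℕ.* suc b)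

  -- With j = b this turns the L-label into the R-label, with j = c into the B-label.
  ratio-weight : ∀ j a q →
    ((1 ℕ.+ 2 ℕ.* j) / (1 ℕ.+ 2 ℕ.* a)) * (odd a * q) ≡ odd j * q
  ratio-weight j a q = trans
    (sym (*-assoc ((1 ℕ.+ 2 ℕ.* j) / (1 ℕ.+ 2 ℕ.* a)) (odd a) q))
    (cong (_* q) (/-*-/ (2 ℕ.* j) (2 ℕ.* a) 0))

-- The factor 1 / f(n − 1) makes T_{L,1,1} = 1.
initialWeight : ℕ → ℕ → ℕ → ℕ → ℚ⁺
initialWeight n = weight (1⁺ ÷ f (n ∸ 1))

-- Induction along the recursion of `initialL`: the left neighbour in a row has b one larger, the
-- predecessor on the left side has c one larger.
initialL-weight : ∀ n r d .(1≤d : 1 ≤ d) .(d≤r : d ≤ r) {a b c} →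
  d ≡ suc a → r ≡ d ℕ.+ b → n ≡ r ℕ.+ c → initialL n r d 1≤d d≤r ≡ initialWeight n a b c
initialL-weight n r (suc (suc a)) 1≤d d≤r {b = b} {c} refl refl refl = trans
  (cong (y r (suc (suc a)) (s≤s (s≤s z≤n)) *_)
        (initialL-weight n r (suc a) (s≤s z≤n) (ℕ.<⇒≤ d≤r) refl (sym (ℕ.+-suc (suc a) b)) refl))
  (y-weight (1⁺ ÷ f (n ∸ 1)) a b c (s≤s (s≤s z≤n)))
initialL-weight n 1 1 _ _ {c = c} refl refl refl = sym (begin
  -- At the top triangle `n` is `suc c`, so the scale is the inverse of `f c`; `odd 0` and `f 0`
  -- compute to `1⁺`.
  odd 0 * (1⁺ * 1⁺ * f c * (1⁺ ÷ f c))  ≡⟨ *-identityˡ (1⁺ * 1⁺ * f c * (1⁺ ÷ f c)) ⟩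
  1⁺ * 1⁺ * f c * (1⁺ ÷ f c)            ≡⟨ cong (_* (1⁺ ÷ f c)) (*-identityˡ (f c)) ⟩
  f c * (1⁺ ÷ f c)                      ≡⟨ p*[1÷p]≡1 (f c) ⟩
  1⁺                                    ∎)
initialL-weight n (suc (suc b)) 1 _ _ {c = c} refl refl refl = trans
  (cong (x n (suc (suc b)) (s≤s (s≤s z≤n)) *_)
        (initialL-weight n (suc b) 1 (s≤s z≤n) (s≤s z≤n) refl refl (sym (ℕ.+-suc (suc b) c))))
  (x-weight (1⁺ ÷ f (n ∸ 1)) b c (s≤s (s≤s z≤n)))

initial-generated : ∀ n → initial n GeneratedBy initialWeight n
initial-generated n L (tri r d 1≤d d≤r _) (coordinates d≡ r≡ n≡) =
  initialL-weight n r d 1≤d d≤r d≡ r≡ n≡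
initial-generated n R (tri r d 1≤d d≤r _) {a} {b} {c} (coordinates refl refl refl) = begin
  rRL r d * initialL n r d 1≤d d≤r
    ≡⟨ cong₂ (λ k l → ((1 ℕ.+ 2 ℕ.* k) / (1 ℕ.+ 2 ℕ.* a)) * l)
             (ℕ.m+n∸m≡n d b) (initialL-weight n r d 1≤d d≤r refl refl refl) ⟩
  ((1 ℕ.+ 2 ℕ.* b) / (1 ℕ.+ 2 ℕ.* a)) * initialWeight n a b c
    ≡⟨ ratio-weight κ b a (common κ a b c) ⟩
  odd b * common κ a b c
    ≡⟨ cong (odd b *_) (common-swap₁₂ κ a b c) ⟩
  initialWeight n b a c
    ∎
  where κ = 1⁺ ÷ f (n ∸ 1)
initial-generated n B (tri r d 1≤d d≤r _) {a} {b} {c} (coordinates refl refl refl) = begin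
  rBL n r d * initialL n r d 1≤d d≤r
    ≡⟨ cong₂ (λ k l → ((1 ℕ.+ 2 ℕ.* k) / (1 ℕ.+ 2 ℕ.* a)) * l)
             (ℕ.m+n∸m≡n r c) (initialL-weight n r d 1≤d d≤r refl refl refl) ⟩
  ((1 ℕ.+ 2 ℕ.* c) / (1 ℕ.+ 2 ℕ.* a)) * initialWeight n a b c
    ≡⟨ ratio-weight κ c a (common κ a b c) ⟩
  odd c * common κ a b c
    ≡⟨ cong (odd c *_) (trans (common-swap₂₃ κ a b c) (common-swap₁₂ κ a c b)) ⟩
  initialWeight n c a b
    ∎
  where κ = 1⁺ ÷ f (n ∸ 1)

theorem3 : ∀ (c i : ℕ) → c > 0 → 1 ≤ i → (i≤c : i ≤ c) →
    VerticalSymmetry (reduced c i i≤c) × SlideSymmetry (reduced c i i≤c)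
theorem3 c i _ _ i≤c =
  let _ , h-sym , gen = reduceTo-generated (ℕ.≤⇒≤′ i≤c)
                          (weight-symmetric (1⁺ ÷ f (c ∸ 1))) (initial-generated c)
  in generated⇒verticalSymmetry h-sym gen , generated⇒slideSymmetry h-sym gen
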